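{- Let $M$ be a finite set, let $(\lambda,\mathcal{L})$ be a ranked lattice of subsets of $M$ and let $\mu$ be a measure on $M$. Then the following are equivalent. (i) There is a polymatroid $(f,M)$ on the ground set $M$ such that $\mathcal{L}$ is exactly the collection of cyclic flats of $(f,M)$, $\lambda(Z)=f(Z)$ for every $Z\in\mathcal{L}$, and $\mu(\{a\})=f(\{a\})$ for every $a\in M$. (ii) All of the following conditions hold: - $\lambda(O_{\mathcal{L}})=0$; - for all $Z_1,Z_2\in\mathcal{L}$ with $Z_1\subsetneq Z_2$: $0<\lambda(Z_2)-\lambda(Z_1)<\mu(Z_2\setminus Z_1)$; - for all $Z_1,Z_2\in\mathcal{L}$: $\lambda(Z_1)+\lambda(Z_2)\ge \lambda(Z_1\lor Z_2)+\lambda(Z_1\land Z_2)+\mu\big((Z_1\cap Z_2)\setminus(Z_1\land Z_2)\big)$; - if $a\in Z\in\mathcal{L}$, then $\mu(\{a\})\le\lambda(Z)$; - $\lambda(Z)>0$ for every $Z\in\mathcal{L}$ with $Z\ne O_{\mathcal{L}}$, and $\mu(\{a\})>0$ for every $a\in M\setminus O_{\mathcal{L}}$. Moreover, when these hold, the polymatroid $(f,M)$ in (i) is unique, and $f$ is integer valued if and only if both $\lambda$ and $\mu$ are integer valued.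
   Context: All sets are finite. A polymatroid $(f,M)$ on ground set $M$ is a non-negative, monotone, submodular real function $f$ on the subsets of $M$ with $f(\emptyset)=0$. A subset $F\subseteq M$ is a flat of $(f,M)$ if $f(F')>f(F)$ for every $F'$ with $F\subsetneq F'\subseteq M$. A flat $C$ is cyclic if for every $i\in C$ either $f(\{i\})=0$ or $f(C)-f(C\setminus\{i\})<f(\{i\})$. A measure on $M$ is a non-negative additive function $\mu$ on the subsets of $M$, i.e. $\mu(A)=\sum_{a\in A}\mu(\{a\})$ with $\mu(\{a\})\ge 0$. A lattice $\mathcal{L}$ of subsets of $M$ is a non-empty collection of subsets of $M$ which is a lattice under the inclusion order: any $Z_1,Z_2\in\mathcal{L}$ have in $\mathcal{L}$ a least upper bound $Z_1\lor Z_2$ and a greatest lower bound $Z_1\land Z_2$ (these need not be the union and the intersection). Its smallest element is denoted $O_{\mathcal{L}}$. A ranked lattice $(\lambda,\mathcal{L})$ is such a lattice with a function $\lambda:\mathcal{L}\to\mathbb{R}_{\ge0}$. -}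

module Defs where

open import Algebra.Bundles using (CommutativeRing)
open import Algebra.Core using (Op₁; Op₂)
open import Algebra.Structures using (IsCommutativeRing)
open import Data.Bool.Base using (if_then_else_)
open import Data.Fin.Base using (Fin)
open import Data.Fin.Subset
  using (Subset; inside; outside; ⊥; ⁅_⁆; _∈_; _∉_; _⊆_; _⊂_; _∩_; _∪_; _─_)
open import Data.Integer.Base using (ℤ; +_; -[1+_])
open import Data.Irrelevant using ([_])
open import Data.Nat.Base using (ℕ; suc)
open import Data.Product.Base using (_×_; _,_; ∃; proj₁; proj₂)
open import Data.Refinement.Base using (Refinement-syntax; value; _,_)
open import Data.Sum.Base using (_⊎_)
open import Data.Vec.Base using ([]; _∷_; lookup)
open import Function.Base using (_∘_; _on_)
open import Function.Bundles using (_⇔_)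
open import Level using (Level; _⊔_) renaming (suc to lsuc)
open import Relation.Binary.Core using (Rel)
open import Relation.Binary.Definitions using (Minimum)
open import Relation.Binary.Lattice.Structures using (IsLattice)
open import Relation.Binary.PropositionalEquality.Core using (_≡_; _≢_)
open import Relation.Binary.Structures using (IsDecTotalOrder)
open import Relation.Nullary using (¬_; Dec; yes; no)
open import Relation.Nullary.Negation.Core using (contradiction-irr)
open import Relation.Unary using (Pred; Decidable)
import Algebra.Properties.Monoid.Mult
import Algebra.Properties.Monoid.Sum
import Relation.Binary.Construct.NonStrictToStrict as Strict

private
  variable
    c ℓ₁ ℓ₂ p : Level
    n : ℕ

-- The axioms of the real numbers: classically, a Dedekind complete ordered
-- field is unique up to isomorphism.  Decidability of the order is part of the
-- classical reading of ℝ.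
record CompleteOrderedField (c ℓ₁ ℓ₂ : Level) : Set (lsuc (c ⊔ ℓ₁ ⊔ ℓ₂)) where
  infix  8 -_
  infixl 7 _*_
  infixl 6 _+_
  infix  4 _≈_ _≤_
  field
    Carrier : Set c
    _≈_     : Rel Carrier ℓ₁
    _≤_     : Rel Carrier ℓ₂
    _+_     : Op₂ Carrier
    _*_     : Op₂ Carrier
    -_      : Op₁ Carrier
    0#      : Carrier
    1#      : Carrier

    isCommutativeRing : IsCommutativeRing _≈_ _+_ _*_ -_ 0# 1#
    0≉1               : ¬ 0# ≈ 1#
    inverse           : ∀ x → ¬ x ≈ 0# → ∃ λ y → x * y ≈ 1#

    isDecTotalOrder : IsDecTotalOrder _≈_ _≤_
    +-monoˡ-≤       : ∀ {x y} z → x ≤ y → x + z ≤ y + z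
    *-nonneg        : ∀ {x y} → 0# ≤ x → 0# ≤ y → 0# ≤ x * y

  UpperBound : Pred Carrier ℓ₂ → Carrier → Set (c ⊔ ℓ₂)
  UpperBound P u = ∀ x → P x → x ≤ u

  field
    complete : (P : Pred Carrier ℓ₂) → ∃ P → ∃ (UpperBound P) →
               ∃ λ s → UpperBound P s × (∀ u → UpperBound P u → s ≤ u)

  commutativeRing : CommutativeRing c ℓ₁
  commutativeRing = record { isCommutativeRing = isCommutativeRing }

  open CommutativeRing commutativeRing public using (_-_; +-monoid)
  open Strict _≈_ _≤_ public using (_<_)
  open Algebra.Properties.Monoid.Sum +-monoid public using (sum)
  private module Mult = Algebra.Properties.Monoid.Mult +-monoid

  fromℤ : ℤ → Carrier
  fromℤ (+ m)    = m Mult.× 1#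
  fromℤ -[1+ m ] = - (suc m Mult.× 1#)

  IsInteger : Carrier → Set ℓ₁
  IsInteger x = ∃ λ k → x ≈ fromℤ k

-- The ground set is Fin n.  The join and the meet are those of the inclusion
-- order restricted to the collection, not union and intersection.
record SubsetLattice (n : ℕ) (p : Level) : Set (lsuc p) where
  field
    Member   : Pred (Subset n) p
    member?  : Decidable Member
    nonempty : ∃ Member

  -- Membership proofs are irrelevant, so that a function on Element is a
  -- function of the underlying subset.
  Element : Set p
  Element = [ Z ∈ Subset n ∣ Member Z ]

  infix 4 _≼_
  _≼_ : Rel Element _
  _≼_ = _⊆_ on value

  infixr 7 _∧_
  infixr 6 _∨_
  field
    _∨_       : Op₂ Element
    _∧_       : Op₂ Element
    isLattice : IsLattice (_≡_ on value) _≼_ _∨_ _∧_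

  open IsLattice isLattice using (x∧y≤x; x∧y≤y)

  private
    ⋀ : ∀ {m} → (Subset m → Element) → Element
    ⋀ {0}     g = g []
    ⋀ {suc m} g = ⋀ (g ∘ (outside ∷_)) ∧ ⋀ (g ∘ (inside ∷_))

    ⋀-lower : ∀ {m} (g : Subset m → Element) Z → ⋀ g ≼ g Z
    ⋀-lower g []            a∈⋀ = a∈⋀
    ⋀-lower g (outside ∷ Z) a∈⋀ =
      ⋀-lower (g ∘ (outside ∷_)) Z
        (x∧y≤x (⋀ (g ∘ (outside ∷_))) (⋀ (g ∘ (inside ∷_))) a∈⋀)
    ⋀-lower g (inside ∷ Z)  a∈⋀ =
      ⋀-lower (g ∘ (inside ∷_)) Z
        (x∧y≤y (⋀ (g ∘ (outside ∷_))) (⋀ (g ∘ (inside ∷_))) a∈⋀)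

    -- Subsets outside the collection are sent to some member, so that the meet
    -- of the whole image is the meet of the collection.
    element : (Z : Subset n) → Dec (Member Z) → Element
    element Z (yes Z∈L) = Z , [ Z∈L ]
    element Z (no _)    = proj₁ nonempty , [ proj₂ nonempty ]

    element-≼ : (Z : Element) (d : Dec (Member (value Z))) →
                element (value Z) d ≼ Z
    element-≼ Z             (yes _)  a∈Z = a∈Z
    element-≼ (_ , [ Z∈L ]) (no Z∉L)     = contradiction-irr Z∈L Z∉L

  O : Element
  O = ⋀ (λ Z → element Z (member? Z))

  O-minimum : Minimum _≼_ O
  O-minimum Z a∈O = element-≼ Z (member? (value Z)) (⋀-lower _ (value Z) a∈O)

module _ (ℝ : CompleteOrderedField c ℓ₁ ℓ₂) where
  open CompleteOrderedField ℝ

  SetFunction : ℕ → Set c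
  SetFunction n = Subset n → Carrier

  record IsPolymatroid (f : SetFunction n) : Set (ℓ₁ ⊔ ℓ₂) where
    field
      empty      : f ⊥ ≈ 0#
      nonneg     : ∀ A → 0# ≤ f A
      monotone   : ∀ A B → A ⊆ B → f A ≤ f B
      submodular : ∀ A B → f (A ∪ B) + f (A ∩ B) ≤ f A + f B

  IsFlat : SetFunction n → Subset n → Set (ℓ₁ ⊔ ℓ₂)
  IsFlat f F = ∀ F′ → F ⊂ F′ → f F < f F′

  IsCyclicFlat : SetFunction n → Subset n → Set (ℓ₁ ⊔ ℓ₂)
  IsCyclicFlat f C =
    IsFlat f C ×
    (∀ i → i ∈ C → f ⁅ i ⁆ ≈ 0# ⊎ f C - f (C ─ ⁅ i ⁆) < f ⁅ i ⁆)

  IntegerValued : ∀ {a} {A : Set a} → (A → Carrier) → Set (a ⊔ ℓ₁)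
  IntegerValued g = ∀ x → IsInteger (g x)

  record Measure (n : ℕ) : Set (c ⊔ ℓ₁ ⊔ ℓ₂) where
    field
      μ        : SetFunction n
      nonneg   : ∀ A → 0# ≤ μ A
      additive : ∀ A → μ A ≈ sum (λ a → if lookup A a then μ ⁅ a ⁆ else 0#)

  record RankedLattice (n : ℕ) (p : Level) : Set (c ⊔ ℓ₂ ⊔ lsuc p) where
    field
      subsetLattice : SubsetLattice n p

    open SubsetLattice subsetLattice public

    field
      rank   : Element → Carrier
      nonneg : ∀ Z → 0# ≤ rank Z

  module _ (Λ : RankedLattice n p) (M : Measure n) where
    open RankedLattice Λ using (Member; Element; _∨_; _∧_; O; rank)
    open Measure M using (μ)

    record Realizes (f : SetFunction n) : Set (p ⊔ ℓ₁ ⊔ ℓ₂) where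
      field
        isPolymatroid : IsPolymatroid f
        cyclicFlats   : ∀ Z → Member Z ⇔ IsCyclicFlat f Z
        rank≈         : ∀ (Z : Element) → rank Z ≈ f (value Z)
        measure≈      : ∀ a → μ ⁅ a ⁆ ≈ f ⁅ a ⁆

    record CyclicFlatAxioms : Set (p ⊔ ℓ₁ ⊔ ℓ₂) where
      field
        rank-O : rank O ≈ 0#
        rank-strict : ∀ (Z₁ Z₂ : Element) → value Z₁ ⊂ value Z₂ →
          0# < rank Z₂ - rank Z₁ ×
          rank Z₂ - rank Z₁ < μ (value Z₂ ─ value Z₁)
        rank-submodular : ∀ (Z₁ Z₂ : Element) →
          rank (Z₁ ∨ Z₂) + rank (Z₁ ∧ Z₂)
            + μ ((value Z₁ ∩ value Z₂) ─ value (Z₁ ∧ Z₂))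
          ≤ rank Z₁ + rank Z₂
        measure≤rank : ∀ a (Z : Element) → a ∈ value Z → μ ⁅ a ⁆ ≤ rank Z
        rank-pos     : ∀ (Z : Element) → value Z ≢ value O → 0# < rank Z
        measure-pos  : ∀ a → a ∉ value O → 0# < μ ⁅ a ⁆

{-# OPTIONS --safe #-}
module Submission where

-- A polymatroid is determined by its cyclic flats and singletons:
-- f A = min { λ Z + μ (A ─ Z) : Z ∈ L }.  The bound ≤ is subadditivity.  It is
-- attained by closing A to a flat F, which does not change f, and then deleting
-- from F, one at a time, the non-loops i with f F - f (F ─ ⁅ i ⁆) = f ⁅ i ⁆:
-- what remains is the largest cyclic flat inside F.  Uniqueness and integrality
-- follow at once, and (i) ⇒ (ii) by applying this to Z₁ ∪ Z₂ and Z₁ ∩ Z₂.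
--
-- Conversely the minimum defines f from (λ, μ).  Adding the bounds for A at Y
-- and for B at Z and applying the third axiom to Y, Z gives submodularity; for
-- A = Z the same axiom gives λ Z ≤ λ Y + μ (Z ─ Y), strictly unless Y = Z, which
-- is what makes the members of L, and only them, cyclic flats.

open import Defs
open import Algebra.Bundles using (CommutativeRing; CommutativeMonoid)
import Algebra.Properties.CommutativeMonoid.Sum
import Algebra.Properties.AbelianGroup
import Algebra.Properties.Monoid.Mult
import Algebra.Solver.CommutativeMonoid
open import Data.Bool.Base as Bool using (true; false; if_then_else_)
open import Data.Fin.Base using (Fin; zero; suc)
open import Data.Fin.Properties using (any?)
open import Data.Fin.Subset
  using (Subset; inside; outside; ⊥; ⁅_⁆; _∈_; _∉_; _⊆_; _⊂_; _∩_; _∪_; _─_)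
open import Data.Fin.Subset.Induction using (Acc; acc; ⊂-wellFounded; ⊃-wellFounded)
open import Data.Fin.Subset.Properties
open import Data.Integer.Base using (+_; -[1+_])
open import Data.Irrelevant using ([_])
open import Data.Nat.Base as ℕ using (ℕ; zero; suc)
open import Data.Product using (_×_; _,_; ∃; ∃!; proj₁; proj₂; uncurry)
open import Data.Refinement.Base using (value; _,_)
open import Data.Sum.Base using (_⊎_; inj₁; inj₂; [_,_]′)
open import Data.Vec.Base using ([]; _∷_; lookup; here; there)
open import Data.Vec.Properties using (lookup-zipWith; []=⇒lookup; lookup⇒[]=)
open import Function.Base using (_∘_; id)
open import Function.Bundles using (_⇔_; mk⇔; Equivalence)
open import Level using (Level)
import Relation.Binary.Construct.NonStrictToStrict as Strict
open import Relation.Binary.Bundles using (DecTotalOrder)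
open import Relation.Binary.Lattice.Structures using (IsLattice)
open import Relation.Binary.PropositionalEquality.Core as ≡ using (_≡_)
import Relation.Binary.Reasoning.PartialOrder
open import Relation.Nullary using (¬_; Dec; yes; no; contradiction)
open import Relation.Nullary.Negation.Core using (contradiction-irr)
open import Relation.Nullary.Decidable using (_×-dec_; ¬?; decidable-stable; recompute)

private
  variable
    c ℓ₁ ℓ₂ p : Level
    n : ℕ
    x : Fin n
    A B C D : Subset n

-- Inclusions and differences of finite subsets.

∈-─⁻ : x ∈ A ─ B → x ∈ A × x ∉ B
∈-─⁻ {A = A} {B} x∈A─B = p─q⊆p A B x∈A─B , ∉B A B x∈A─B
  where
  ∉B : ∀ {n} {x : Fin n} A B → x ∈ A ─ B → x ∉ B
  ∉B (inside ∷ A) (outside ∷ B) here       ()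
  ∉B (_ ∷ A)      (_ ∷ B)       (there x∈) (there x∈B) = ∉B A B x∈ x∈B

⁅⁆⊆ : x ∈ A → ⁅ x ⁆ ⊆ A
⁅⁆⊆ {A = A} x∈A y∈⁅x⁆ = ≡.subst (_∈ A) (≡.sym (x∈⁅y⁆⇒x≡y _ y∈⁅x⁆)) x∈A

∪-least : A ⊆ C → B ⊆ C → A ∪ B ⊆ C
∪-least {A = A} {B = B} A⊆C B⊆C = [ A⊆C , B⊆C ]′ ∘ x∈p∪q⁻ A B

∩-greatest : C ⊆ A → C ⊆ B → C ⊆ A ∩ B
∩-greatest C⊆A C⊆B x∈C = x∈p∩q⁺ (C⊆A x∈C , C⊆B x∈C)

A⊆B∪A─B : ∀ (A B : Subset n) → A ⊆ B ∪ (A ─ B)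
A⊆B∪A─B A B {x} x∈A with x ∈? B
... | yes x∈B = x∈p∪q⁺ (inj₁ x∈B)
... | no  x∉B = x∈p∪q⁺ (inj₂ (x∈p∧x∉q⇒x∈p─q x∈A x∉B))

─-mono : A ⊆ C → D ⊆ B → A ─ B ⊆ C ─ D
─-mono A⊆C D⊆B x∈ = let (x∈A , x∉B) = ∈-─⁻ x∈ in
  x∈p∧x∉q⇒x∈p─q (A⊆C x∈A) (x∉B ∘ D⊆B)

-- Strict inclusion carries a witness point, and a failed inclusion yields one only after a search
-- through the finite ground set.
⊆∧⊉⇒⊂ : A ⊆ B → ¬ B ⊆ A → A ⊂ B
⊆∧⊉⇒⊂ {A = A} {B} A⊆B B⊈A with any? (λ x → (x ∈? B) ×-dec ¬? (x ∈? A))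
... | yes B∌A = A⊆B , B∌A
... | no  B⊆A = contradiction
  (λ {x} x∈B → decidable-stable (x ∈? A) (λ x∉A → B⊆A (x , x∈B , x∉A))) B⊈A

⊂-insert : x ∉ A → A ⊂ A ∪ ⁅ x ⁆
⊂-insert {x = x} {A} x∉A = p⊆p∪q _ , x , q⊆p∪q A _ (x∈⁅x⁆ x) , x∉A

-- Arithmetic in the ordered field, finite minima and integers.

module OrderedField (ℝ : CompleteOrderedField c ℓ₁ ℓ₂) where
  open CompleteOrderedField ℝ public

  open CommutativeRing commutativeRing public
    using (refl; sym; trans; +-cong; +-congˡ; +-congʳ; +-comm; +-assoc
          ; +-identityˡ; +-identityʳ; -‿inverseʳ; -‿cong; +-commutativeMonoid)
  open Algebra.Properties.AbelianGroup
    (CommutativeRing.+-abelianGroup commutativeRing) public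
    using () renaming (∙-cancelʳ to +-cancelʳ; //-rightDividesˡ to x-y+y≈x
                      ; ⁻¹-∙-comm to -x-y≈-[x+y]; ε⁻¹≈ε to -0≈0)
  open Algebra.Properties.CommutativeMonoid.Sum +-commutativeMonoid public
    using (∑-distrib-+; sum-cong-≋; sum-replicate-zero)
  open Algebra.Properties.Monoid.Mult +-monoid public using (×-homo-+)
  module +-Solver = Algebra.Solver.CommutativeMonoid +-commutativeMonoid

  decTotalOrder : DecTotalOrder c ℓ₁ ℓ₂
  decTotalOrder = record { isDecTotalOrder = isDecTotalOrder }

  open DecTotalOrder decTotalOrder public using (poset; _≟_; _≤?_; total)
    renaming (refl to ≤-refl; reflexive to ≤-reflexive; trans to ≤-trans; antisym to ≤-antisym)
  module ≤-Reasoning = Relation.Binary.Reasoning.PartialOrder poset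

  <⇒≤ : ∀ {x y} → x < y → x ≤ y
  <⇒≤ = proj₁

  <⇒≱ : ∀ {x y} → x < y → ¬ y ≤ x
  <⇒≱ = Strict.<⇒≱ _≈_ _≤_ ≤-antisym

  ≰⇒> : ∀ {x y} → ¬ x ≤ y → y < x
  ≰⇒> = Strict.≰⇒> _≈_ _≤_ sym ≤-reflexive total

  ≮⇒≥ : ∀ {x y} → ¬ x < y → y ≤ x
  ≮⇒≥ = Strict.≮⇒≥ _≈_ _≤_ sym _≟_ ≤-reflexive total

  _<?_ : ∀ x y → Dec (x < y)
  _<?_ = Strict.<-decidable _≈_ _≤_ _≟_ _≤?_

  +-monoʳ-≤ : ∀ {x y} z → x ≤ y → z + x ≤ z + y
  +-monoʳ-≤ {x} {y} z x≤y = begin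
    z + x  ≈⟨ +-comm z x ⟩
    x + z  ≤⟨ +-monoˡ-≤ z x≤y ⟩
    y + z  ≈⟨ +-comm y z ⟩
    z + y  ∎
    where open ≤-Reasoning

  +-mono-≤ : ∀ {x y u v} → x ≤ y → u ≤ v → x + u ≤ y + v
  +-mono-≤ x≤y u≤v = ≤-trans (+-monoˡ-≤ _ x≤y) (+-monoʳ-≤ _ u≤v)

  +-monoˡ-< : ∀ {x y} z → x < y → x + z < y + z
  +-monoˡ-< z (x≤y , x≉y) = +-monoˡ-≤ z x≤y , x≉y ∘ +-cancelʳ _ _ _

  +-monoʳ-< : ∀ {x y} z → x < y → z + x < z + y
  +-monoʳ-< {x} {y} z x<y = begin-strict
    z + x  ≈⟨ +-comm z x ⟩
    x + z  <⟨ +-monoˡ-< z x<y ⟩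
    y + z  ≈⟨ +-comm y z ⟩
    z + y  ∎
    where open ≤-Reasoning

  +-cancelʳ-≤ : ∀ {x y} z → x + z ≤ y + z → x ≤ y
  +-cancelʳ-≤ {x} {y} z x+z≤y+z =
    ≮⇒≥ (λ y<x → <⇒≱ (+-monoˡ-< z y<x) x+z≤y+z)

  +-cancelʳ-< : ∀ {x y} z → x + z < y + z → x < y
  +-cancelʳ-< z x+z<y+z = ≰⇒> (λ y≤x → <⇒≱ x+z<y+z (+-monoˡ-≤ z y≤x))

  x≤x+y : ∀ {x y} → 0# ≤ y → x ≤ x + y
  x≤x+y {x} {y} 0≤y = begin
    x       ≈⟨ +-identityʳ x ⟨
    x + 0#  ≤⟨ +-monoʳ-≤ x 0≤y ⟩
    x + y   ∎
    where open ≤-Reasoning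

  y≤x+y : ∀ {x y} → 0# ≤ x → y ≤ x + y
  y≤x+y 0≤x = ≤-trans (x≤x+y 0≤x) (≤-reflexive (+-comm _ _))

  x<x+y : ∀ {x y} → 0# < y → x < x + y
  x<x+y {x} {y} 0<y = begin-strict
    x       ≈⟨ +-identityʳ x ⟨
    x + 0#  <⟨ +-monoʳ-< x 0<y ⟩
    x + y   ∎
    where open ≤-Reasoning

  0<y-x⇒x<y : ∀ {x y} → 0# < y - x → x < y
  0<y-x⇒x<y {x} {y} 0<y-x = begin-strict
    x          ≈⟨ +-identityˡ x ⟨
    0# + x     <⟨ +-monoˡ-< x 0<y-x ⟩
    y - x + x  ≈⟨ x-y+y≈x x y ⟩
    y          ∎
    where open ≤-Reasoning

  x<y⇒0<y-x : ∀ {x y} → x < y → 0# < y - x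
  x<y⇒0<y-x {x} {y} x<y = begin-strict
    0#     ≈⟨ -‿inverseʳ x ⟨
    x - x  <⟨ +-monoˡ-< (- x) x<y ⟩
    y - x  ∎
    where open ≤-Reasoning

  x-y<z⇒x<z+y : ∀ {x y z} → x - y < z → x < z + y
  x-y<z⇒x<z+y {x} {y} {z} x-y<z = begin-strict
    x          ≈⟨ x-y+y≈x y x ⟨
    x - y + y  <⟨ +-monoˡ-< y x-y<z ⟩
    z + y      ∎
    where open ≤-Reasoning

  x<z+y⇒x-y<z : ∀ {x y z} → x < z + y → x - y < z
  x<z+y⇒x-y<z {x} {y} {z} x<z+y = +-cancelʳ-< y (begin-strict
    x - y + y  ≈⟨ x-y+y≈x y x ⟩
    x          <⟨ x<z+y ⟩
    z + y      ∎)
    where open ≤-Reasoning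

  sum-mono-≤ : ∀ {n} {s t : Fin n → Carrier} →
               (∀ i → s i ≤ t i) → sum s ≤ sum t
  sum-mono-≤ {zero}  s≤t = ≤-refl
  sum-mono-≤ {suc n} s≤t = +-mono-≤ (s≤t zero) (sum-mono-≤ (s≤t ∘ suc))

  -- The subsets split into two halves by their first coordinate, and the better of the two
  -- minimisers is kept. The map `g` serves as an enumeration of those values in `X` over which the
  -- minimum is wanted.
  minimizer : ∀ {a m} {X : Set a} (w : X → Carrier) (g : Subset m → X) →
              ∃ λ A → ∀ B → w (g A) ≤ w (g B)
  minimizer {m = zero}  w g = [] , λ { [] → ≤-refl }
  minimizer {m = suc m} w g
    with minimizer w (g ∘ (outside ∷_)) | minimizer w (g ∘ (inside ∷_))
  ... | A , A≤ | B , B≤ with total (w (g (outside ∷ A))) (w (g (inside ∷ B)))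
  ... | inj₁ A≤B = outside ∷ A , λ { (outside ∷ C) → A≤ C
                                   ; (inside  ∷ C) → ≤-trans A≤B (B≤ C) }
  ... | inj₂ B≤A = inside ∷ B , λ { (outside ∷ C) → ≤-trans B≤A (A≤ C)
                                  ; (inside  ∷ C) → B≤ C }

  IsInteger-resp-≈ : ∀ {x y} → x ≈ y → IsInteger x → IsInteger y
  IsInteger-resp-≈ x≈y (k , x≈k) = k , trans (sym x≈y) x≈k

  IsInteger-0 : IsInteger 0#
  IsInteger-0 = + 0 , refl

  private
    _·1 : ℕ → Carrier
    m ·1 = fromℤ (+ m)

    ·1-+-homo : ∀ k m → (k ℕ.+ m) ·1 ≈ k ·1 + m ·1
    ·1-+-homo = ×-homo-+ 1#

    -- The mixed-sign cases of `IsInteger-+` reduce to this. Taking 1 from both numbers until one of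
    -- them is zero reveals the sign of the result.
    IsInteger-difference : ∀ k m → IsInteger (k ·1 - m ·1)
    IsInteger-difference k       zero    =
      + k , trans (+-congˡ -0≈0) (+-identityʳ _)
    IsInteger-difference zero    (suc m) = -[1+ m ] , +-identityˡ _
    IsInteger-difference (suc k) (suc m) =
      IsInteger-resp-≈ (sym difference≈) (IsInteger-difference k m)
      where
      open ≤-Reasoning
      open +-Solver using (solve; _⊜_; _⊕_)
      difference≈ : suc k ·1 - suc m ·1 ≈ k ·1 - m ·1
      difference≈ = begin-equality
        1# + k ·1 - (1# + m ·1)
          ≈⟨ +-congˡ (sym (-x-y≈-[x+y] 1# (m ·1))) ⟩
        1# + k ·1 + (- 1# - m ·1)
          ≈⟨ solve 4 (λ a b c d → ((a ⊕ b) ⊕ (c ⊕ d)) ⊜ ((a ⊕ c) ⊕ (b ⊕ d)))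
               refl 1# (k ·1) (- 1#) (- (m ·1)) ⟩
        1# - 1# + (k ·1 - m ·1)
          ≈⟨ +-congʳ (-‿inverseʳ 1#) ⟩
        0# + (k ·1 - m ·1)
          ≈⟨ +-identityˡ _ ⟩
        k ·1 - m ·1  ∎

  IsInteger-+ : ∀ {x y} → IsInteger x → IsInteger y → IsInteger (x + y)
  IsInteger-+ (+ k , x≈k) (+ m , y≈m) =
    + (k ℕ.+ m) , trans (+-cong x≈k y≈m) (sym (·1-+-homo k m))
  IsInteger-+ (+ k , x≈k) (-[1+ m ] , y≈m) =
    IsInteger-resp-≈ (sym (+-cong x≈k y≈m)) (IsInteger-difference k (suc m))
  IsInteger-+ (-[1+ k ] , x≈k) (+ m , y≈m) =
    IsInteger-resp-≈ (sym (trans (+-cong x≈k y≈m) (+-comm _ _)))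
      (IsInteger-difference m (suc k))
  IsInteger-+ (-[1+ k ] , x≈k) (-[1+ m ] , y≈m) =
    -[1+ k ℕ.+ suc m ] ,
    trans (+-cong x≈k y≈m)
      (trans (-x-y≈-[x+y] _ _) (-‿cong (sym (·1-+-homo (suc k) (suc m)))))

  IsInteger-sum : ∀ {n} (t : Fin n → Carrier) →
                  (∀ i → IsInteger (t i)) → IsInteger (sum t)
  IsInteger-sum {zero}  t t∈ℤ = IsInteger-0
  IsInteger-sum {suc n} t t∈ℤ =
    IsInteger-+ (t∈ℤ zero) (IsInteger-sum (t ∘ suc) (t∈ℤ ∘ suc))

-- Measures: monotonicity, modularity and integrality.

module MeasureProperties
  (ℝ : CompleteOrderedField c ℓ₁ ℓ₂) (M : Measure ℝ n) where
  open OrderedField ℝ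
  open Measure M
  open ≤-Reasoning

  private
    restrict : Subset n → Fin n → Carrier
    restrict A a = if lookup A a then μ ⁅ a ⁆ else 0#

    restrict-mono : A ⊆ B → ∀ a → restrict A a ≤ restrict B a
    restrict-mono {A} {B} A⊆B a with lookup A a in a∈A | lookup B a in a∈B
    ... | false | false = ≤-refl
    ... | false | true  = nonneg ⁅ a ⁆
    ... | true  | true  = ≤-refl
    ... | true  | false with () ← ≡.trans (≡.sym a∈B)
                                  ([]=⇒lookup (A⊆B (lookup⇒[]= a A a∈A)))

    -- Additivity is given as a sum over points, so modularity is checked at each point, by the four
    -- cases of membership in `A` and `B`.
    restrict-modular : ∀ A B a → restrict (A ∪ B) a + restrict (A ∩ B) a ≈
                                 restrict A a + restrict B a
    restrict-modular A B a
      rewrite lookup-zipWith Bool._∨_ a A B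
            | lookup-zipWith Bool._∧_ a A B
      with lookup A a | lookup B a
    ... | false | false = refl
    ... | false | true  = +-comm _ _
    ... | true  | false = refl
    ... | true  | true  = refl

  μ-mono : A ⊆ B → μ A ≤ μ B
  μ-mono {A} {B} A⊆B = begin
    μ A               ≈⟨ additive A ⟩
    sum (restrict A)  ≤⟨ sum-mono-≤ (restrict-mono A⊆B) ⟩
    sum (restrict B)  ≈⟨ additive B ⟨
    μ B               ∎

  μ-modular : ∀ A B → μ (A ∪ B) + μ (A ∩ B) ≈ μ A + μ B
  μ-modular A B = begin-equality
    μ (A ∪ B) + μ (A ∩ B)
      ≈⟨ +-cong (additive _) (additive _) ⟩
    sum (restrict (A ∪ B)) + sum (restrict (A ∩ B))
      ≈⟨ ∑-distrib-+ (restrict (A ∪ B)) (restrict (A ∩ B)) ⟨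
    sum (λ a → restrict (A ∪ B) a + restrict (A ∩ B) a)
      ≈⟨ sum-cong-≋ (restrict-modular A B) ⟩
    sum (λ a → restrict A a + restrict B a)
      ≈⟨ ∑-distrib-+ (restrict A) (restrict B) ⟩
    sum (restrict A) + sum (restrict B)
      ≈⟨ +-cong (additive A) (additive B) ⟨
    μ A + μ B  ∎

  μ-empty : (∀ a → a ∉ A) → μ A ≈ 0#
  μ-empty {A} A-empty = begin-equality
    μ A                       ≈⟨ additive A ⟩
    sum (restrict A)          ≈⟨ sum-cong-≋ restrict≈0 ⟩
    sum (λ (_ : Fin n) → 0#)  ≈⟨ sum-replicate-zero n ⟩
    0#                        ∎
    where
    restrict≈0 : ∀ a → restrict A a ≈ 0#
    restrict≈0 a with lookup A a in a∈A
    ... | false = refl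
    ... | true  = contradiction (lookup⇒[]= a A a∈A) (A-empty a)

  μ-subadditive : A ⊆ B ∪ C → μ A ≤ μ B + μ C
  μ-subadditive {A} {B} {C} A⊆B∪C = begin
    μ A                    ≤⟨ μ-mono A⊆B∪C ⟩
    μ (B ∪ C)              ≤⟨ x≤x+y (nonneg _) ⟩
    μ (B ∪ C) + μ (B ∩ C)  ≈⟨ μ-modular B C ⟩
    μ B + μ C              ∎

  μ-superadditive : B ⊆ A → C ⊆ A → (∀ {a} → a ∈ B → a ∉ C) → μ B + μ C ≤ μ A
  μ-superadditive {B} {A} {C} B⊆A C⊆A disjoint = begin
    μ B + μ C              ≈⟨ μ-modular B C ⟨
    μ (B ∪ C) + μ (B ∩ C)  ≈⟨ +-congˡ (μ-empty λ a → uncurry disjoint ∘ x∈p∩q⁻ B C) ⟩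
    μ (B ∪ C) + 0#         ≈⟨ +-identityʳ _ ⟩
    μ (B ∪ C)              ≤⟨ μ-mono (∪-least B⊆A C⊆A) ⟩
    μ A                    ∎

  IntegerValued-μ : (∀ a → IsInteger (μ ⁅ a ⁆)) → IntegerValued ℝ μ
  IntegerValued-μ μ∈ℤ A =
    IsInteger-resp-≈ (sym (additive A)) (IsInteger-sum _ restrict∈ℤ)
    where
    restrict∈ℤ : ∀ a → IsInteger (restrict A a)
    restrict∈ℤ a with lookup A a
    ... | true  = μ∈ℤ a
    ... | false = IsInteger-0

-- Polymatroids: domination by the measure, closure, and the cyclic part of a flat.

module PolymatroidProperties
  (ℝ : CompleteOrderedField c ℓ₁ ℓ₂) (M : Measure ℝ n)
  {f : SetFunction ℝ n} (isPolymatroid : IsPolymatroid ℝ f)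
  (μ≈f : ∀ a → CompleteOrderedField._≈_ ℝ (Measure.μ M ⁅ a ⁆) (f ⁅ a ⁆)) where

  open OrderedField ℝ
  open MeasureProperties ℝ M
  open Measure M using (μ) renaming (nonneg to μ-nonneg)
  open IsPolymatroid isPolymatroid
  open ≤-Reasoning

  f-mono : A ⊆ B → f A ≤ f B
  f-mono = monotone _ _

  f-submodular : C ⊆ A ∪ B → D ⊆ A ∩ B → f C + f D ≤ f A + f B
  f-submodular C⊆A∪B D⊆A∩B =
    ≤-trans (+-mono-≤ (f-mono C⊆A∪B) (f-mono D⊆A∩B)) (submodular _ _)

  f-subadditive : A ⊆ B ∪ C → f A ≤ f B + f C
  f-subadditive {A} {B} {C} A⊆B∪C =
    ≤-trans (x≤x+y (nonneg (B ∩ C))) (f-submodular A⊆B∪C id)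

  -- The sets `A ∪ ⁅ x ⁆` and `B` have a union containing `B ∪ ⁅ x ⁆` and an intersection containing
  -- `A`. So the gain from adding `x` shrinks as the set grows.
  diminishing : A ⊆ B → f (B ∪ ⁅ x ⁆) + f A ≤ f (A ∪ ⁅ x ⁆) + f B
  diminishing {A} {B} {x} A⊆B = f-submodular
    (∪-least (q⊆p∪q _ _) (p⊆p∪q B ∘ q⊆p∪q A _))
    (∩-greatest (p⊆p∪q _) A⊆B)

  -- Elements are deleted one at a time; by subadditivity each deletion of `i` lowers `f` by at most
  -- `f ⁅ i ⁆`, which is `μ ⁅ i ⁆`.
  f≤μ : ∀ A → f A ≤ μ A
  f≤μ A = go A (⊂-wellFounded A)
    where
    go : ∀ A → Acc _⊂_ A → f A ≤ μ A
    go A (acc rec) with nonempty? A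
    ... | no  A-empty with ≡.refl ← Empty-unique A-empty = begin
      f ⊥  ≈⟨ empty ⟩
      0#   ≤⟨ μ-nonneg ⊥ ⟩
      μ ⊥  ∎
    ... | yes (i , i∈A) = begin
      f A                    ≤⟨ f-subadditive (∪-comm-⊆ (A⊆B∪A─B A ⁅ i ⁆)) ⟩
      f (A ─ ⁅ i ⁆) + f ⁅ i ⁆  ≤⟨ +-mono-≤ (go _ (rec (x∈p⇒p-x⊂p i∈A)))
                                         (≤-reflexive (sym (μ≈f i))) ⟩
      μ (A ─ ⁅ i ⁆) + μ ⁅ i ⁆  ≤⟨ μ-superadditive (p─q⊆p A _) (⁅⁆⊆ i∈A)
                                                (proj₂ ∘ ∈-─⁻) ⟩
      μ A                    ∎
      where
      ∪-comm-⊆ : A ⊆ B ∪ C → A ⊆ C ∪ B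
      ∪-comm-⊆ {B = B} {C} A⊆ = ∪-least (q⊆p∪q C B) (p⊆p∪q B) ∘ A⊆

  f≤f+μ : ∀ A C → f A ≤ f C + μ (A ─ C)
  f≤f+μ A C = ≤-trans (f-subadditive (A⊆B∪A─B A C)) (+-monoʳ-≤ _ (f≤μ _))

  -- Points that do not raise `f` are added until none is left. Each of them lies in every flat
  -- above `A`, so the result is the least such flat.
  closure : ∀ A → ∃ λ F → IsFlat ℝ f F × A ⊆ F × f F ≤ f A ×
            (∀ G → IsFlat ℝ f G → A ⊆ G → F ⊆ G)
  closure A = go A (⊃-wellFounded A)
    where
    go : ∀ A → Acc (λ B C → C ⊂ B) A → ∃ λ F → IsFlat ℝ f F × A ⊆ F × f F ≤ f A ×
         (∀ G → IsFlat ℝ f G → A ⊆ G → F ⊆ G)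
    go A (acc rec) with any? (λ x → ¬? (x ∈? A) ×-dec (f (A ∪ ⁅ x ⁆) ≤? f A))
    ... | no ∄x = A , A-flat , id , ≤-refl , λ _ _ → id
      where
      A-flat : IsFlat ℝ f A
      A-flat F′ (A⊆F′ , x , x∈F′ , x∉A) = begin-strict
        f A            <⟨ ≰⇒> (λ f≤ → ∄x (x , x∉A , f≤)) ⟩
        f (A ∪ ⁅ x ⁆)  ≤⟨ f-mono (∪-least A⊆F′ (⁅⁆⊆ x∈F′)) ⟩
        f F′           ∎
    ... | yes (x , x∉A , fA∪x≤fA)
      with go (A ∪ ⁅ x ⁆) (rec (⊂-insert x∉A))
    ... | F , F-flat , A∪x⊆F , fF≤fA∪x , F-least =
      F , F-flat , A∪x⊆F ∘ p⊆p∪q _ , ≤-trans fF≤fA∪x fA∪x≤fA ,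
      λ G G-flat A⊆G → F-least G G-flat (∪-least A⊆G (⁅⁆⊆ (x∈G G-flat A⊆G)))
      where
      x∈G : ∀ {G} → IsFlat ℝ f G → A ⊆ G → x ∈ G
      -- Were `x` outside `G`, its zero gain over `A` would by `diminishing` be a zero gain over
      -- `G`, against flatness.
      x∈G {G} G-flat A⊆G = decidable-stable (x ∈? G) λ x∉G → <⇒≱
        (G-flat (G ∪ ⁅ x ⁆) (⊂-insert x∉G))
        (+-cancelʳ-≤ (f A) (begin
          f (G ∪ ⁅ x ⁆) + f A  ≤⟨ diminishing A⊆G ⟩
          f (A ∪ ⁅ x ⁆) + f G  ≤⟨ +-monoˡ-≤ (f G) fA∪x≤fA ⟩
          f A + f G            ≈⟨ +-comm _ _ ⟩
          f G + f A            ∎))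

  -- Deleting an element i with f F - f (F ─ ⁅ i ⁆) = f ⁅ i ⁆ > 0 keeps a flat
  -- flat, and by submodularity i lies in no cyclic flat below F.
  cyclicPart : ∀ F → IsFlat ℝ f F → ∃ λ C → IsCyclicFlat ℝ f C × C ⊆ F ×
               f C + μ (F ─ C) ≤ f F × (∀ D → IsCyclicFlat ℝ f D → D ⊆ F → D ⊆ C)
  cyclicPart F = go F (⊂-wellFounded F)
    where
    go : ∀ F → Acc _⊂_ F → IsFlat ℝ f F → ∃ λ C → IsCyclicFlat ℝ f C × C ⊆ F ×
         f C + μ (F ─ C) ≤ f F × (∀ D → IsCyclicFlat ℝ f D → D ⊆ F → D ⊆ C)
    go F (acc rec) F-flat
      with any? (λ i → (i ∈? F) ×-dec ¬? (f ⁅ i ⁆ ≟ 0#) ×-dec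
                       ¬? ((f F - f (F ─ ⁅ i ⁆)) <? f ⁅ i ⁆))
    ... | no ∄i = F , (F-flat , F-cyclic) , id , f+μ≤f , λ _ _ → id
      where
      F-cyclic : ∀ i → i ∈ F → f ⁅ i ⁆ ≈ 0# ⊎ f F - f (F ─ ⁅ i ⁆) < f ⁅ i ⁆
      F-cyclic i i∈F with f ⁅ i ⁆ ≟ 0#
      ... | yes fi≈0 = inj₁ fi≈0
      ... | no  fi≉0 = inj₂ (decidable-stable (_ <? _) λ ≮ → ∄i (i , i∈F , fi≉0 , ≮))
      f+μ≤f : f F + μ (F ─ F) ≤ f F
      f+μ≤f = begin
        f F + μ (F ─ F)  ≈⟨ +-congˡ (μ-empty (λ a a∈ → uncurry contradiction (∈-─⁻ a∈))) ⟩
        f F + 0#         ≈⟨ +-identityʳ _ ⟩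
        f F              ∎
    ... | yes (i , i∈F , fi≉0 , ≮fi) = result
      where
      F′ = F ─ ⁅ i ⁆

      F⊆F′∪i : ∀ {G} → F′ ⊆ G → i ∈ G → F ⊆ G
      F⊆F′∪i F′⊆G i∈G = ∪-least (⁅⁆⊆ i∈G) F′⊆G ∘ A⊆B∪A─B F ⁅ i ⁆

      f+f≤f : f ⁅ i ⁆ + f F′ ≤ f F
      f+f≤f = ≮⇒≥ (≮fi ∘ x<z+y⇒x-y<z)

      F′-flat : IsFlat ℝ f F′
      F′-flat G (F′⊆G , x , x∈G , x∉F′) with i ∈? G
      ... | yes i∈G = begin-strict
        f F′            <⟨ x<x+y (nonneg ⁅ i ⁆ , fi≉0 ∘ sym) ⟩
        f F′ + f ⁅ i ⁆  ≈⟨ +-comm _ _ ⟩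
        f ⁅ i ⁆ + f F′  ≤⟨ f+f≤f ⟩
        f F             ≤⟨ f-mono (F⊆F′∪i F′⊆G i∈G) ⟩
        f G             ∎
      -- Here `x` differs from `i`, so `x` lies outside `F`; its positive gain over the flat `F` is
      -- at most its gain over the smaller `F′`.
      ... | no i∉G = +-cancelʳ-< (f F) (begin-strict
        f F′ + f F            ≈⟨ +-comm _ _ ⟩
        f F + f F′            <⟨ +-monoˡ-< _ (F-flat (F ∪ ⁅ x ⁆) (⊂-insert x∉F)) ⟩
        f (F ∪ ⁅ x ⁆) + f F′  ≤⟨ diminishing (p─q⊆p F _) ⟩
        f (F′ ∪ ⁅ x ⁆) + f F  ≤⟨ +-monoˡ-≤ _ (f-mono (∪-least F′⊆G (⁅⁆⊆ x∈G))) ⟩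
        f G + f F             ∎)
        where
        x∉F : x ∉ F
        x∉F x∈F = x∉F′ (x∈p∧x∉q⇒x∈p─q x∈F
          λ x∈i → i∉G (≡.subst (_∈ G) (x∈⁅y⁆⇒x≡y i x∈i) x∈G))

      i∉cyclic : ∀ D → IsCyclicFlat ℝ f D → D ⊆ F → i ∉ D
      i∉cyclic D (_ , D-cyclic) D⊆F i∈D with D-cyclic i i∈D
      ... | inj₁ fi≈0 = fi≉0 fi≈0
      ... | inj₂ <fi  = <⇒≱ <fi′ (+-cancelʳ-≤ (f F′) (begin
        f ⁅ i ⁆ + f D′ + f F′    ≈⟨ solve 3 (λ a b c → ((a ⊕ b) ⊕ c) ⊜ ((a ⊕ c) ⊕ b))
                                      refl _ _ _ ⟩
        f ⁅ i ⁆ + f F′ + f D′    ≤⟨ +-monoˡ-≤ _ f+f≤f ⟩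
        -- The union of `D` and `F′` restores `F`, and their intersection contains `D′`. Hence `i`
        -- contributes its full `f ⁅ i ⁆` to `D` as well, against cyclicity.
        f F + f D′               ≤⟨ f-submodular
                                      (F⊆F′∪i (q⊆p∪q D F′) (p⊆p∪q F′ i∈D))
                                      (∩-greatest (p─q⊆p D _) (─-mono D⊆F id)) ⟩
        f D + f F′               ∎))
        where
        open +-Solver using (solve; _⊜_; _⊕_)
        D′ = D ─ ⁅ i ⁆
        <fi′ = x-y<z⇒x<z+y <fi

      result : ∃ λ C → IsCyclicFlat ℝ f C × C ⊆ F ×
               f C + μ (F ─ C) ≤ f F × (∀ D → IsCyclicFlat ℝ f D → D ⊆ F → D ⊆ C)
      result with go F′ (rec (x∈p⇒p-x⊂p i∈F)) F′-flat
      ... | C , C-cyclicFlat , C⊆F′ , f+μ≤f , C-greatest =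
        C , C-cyclicFlat , p─q⊆p F _ ∘ C⊆F′ , (begin
          f C + μ (F ─ C)               ≤⟨ +-monoʳ-≤ _ (μ-subadditive F─C⊆) ⟩
          f C + (μ (F′ ─ C) + μ ⁅ i ⁆)  ≈⟨ +-assoc _ _ _ ⟨
          f C + μ (F′ ─ C) + μ ⁅ i ⁆    ≤⟨ +-mono-≤ f+μ≤f (≤-reflexive (μ≈f i)) ⟩
          f F′ + f ⁅ i ⁆                ≈⟨ +-comm _ _ ⟩
          f ⁅ i ⁆ + f F′                ≤⟨ f+f≤f ⟩
          f F                           ∎) ,
        λ D D-cyclicFlat D⊆F → C-greatest D D-cyclicFlat λ x∈D →
          x∈p∧x∉q⇒x∈p─q (D⊆F x∈D) λ x∈i → i∉cyclic D D-cyclicFlat D⊆F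
            (≡.subst (_∈ D) (x∈⁅y⁆⇒x≡y i x∈i) x∈D)
        where
        F─C⊆ : F ─ C ⊆ (F′ ─ C) ∪ ⁅ i ⁆
        F─C⊆ {x} x∈F─C with ∈-─⁻ x∈F─C | x ∈? ⁅ i ⁆
        ... | _         , _   | yes x∈i = q⊆p∪q _ _ x∈i
        ... | x∈F , x∉C | no  x∉i =
          p⊆p∪q _ (x∈p∧x∉q⇒x∈p─q (x∈p∧x∉q⇒x∈p─q x∈F x∉i) x∉C)

  -- The cyclic part of the closure of `A`. The inequality makes the minimum attained. That `C`
  -- contains the cyclic flats inside `A` locates joins, and that it lies in the flats above `A`
  -- locates meets.
  decomposition : ∀ A → ∃ λ C → IsCyclicFlat ℝ f C × f C + μ (A ─ C) ≤ f A ×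
                  (∀ D → IsCyclicFlat ℝ f D → D ⊆ A → D ⊆ C) ×
                  (∀ G → IsFlat ℝ f G → A ⊆ G → C ⊆ G)
  decomposition A with closure A
  ... | F , F-flat , A⊆F , fF≤fA , F-least with cyclicPart F F-flat
  ... | C , C-cyclicFlat , C⊆F , f+μ≤f , C-greatest =
    C , C-cyclicFlat , (begin
      f C + μ (A ─ C)  ≤⟨ +-monoʳ-≤ _ (μ-mono (─-mono A⊆F id)) ⟩
      f C + μ (F ─ C)  ≤⟨ f+μ≤f ⟩
      f F              ≤⟨ fF≤fA ⟩
      f A              ∎) ,
    (λ D D-cyclicFlat D⊆A → C-greatest D D-cyclicFlat (A⊆F ∘ D⊆A)) ,
    (λ G G-flat A⊆G → F-least G G-flat A⊆G ∘ C⊆F)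

-- From a polymatroid to the axioms on its cyclic flats.

module Necessity
  (ℝ : CompleteOrderedField c ℓ₁ ℓ₂) (Λ : RankedLattice ℝ n p) (M : Measure ℝ n)
  {f : SetFunction ℝ n} (realizes : Realizes ℝ Λ M f) where

  open OrderedField ℝ
  open MeasureProperties ℝ M
  open RankedLattice Λ
    using (member?; Element; _∨_; _∧_; O; O-minimum; rank; isLattice)
  open IsLattice isLattice using (x≤x∨y; y≤x∨y; ∨-least; x∧y≤x; x∧y≤y; ∧-greatest)
  open Measure M using (μ)
  open Realizes realizes
  open IsPolymatroid isPolymatroid using (empty) renaming (nonneg to f-nonneg)
  open PolymatroidProperties ℝ M isPolymatroid measure≈
  open ≤-Reasoning

  private
    -- An `Element` holds its membership proof irrelevantly; decidability of membership recovers a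
    -- proof that can be used.
    cyclicFlat : (Z : Element) → IsCyclicFlat ℝ f (value Z)
    cyclicFlat (Z , [ Z∈L ]) =
      Equivalence.to (cyclicFlats Z) (recompute (member? Z) Z∈L)

    element : ∀ C → IsCyclicFlat ℝ f C → Element
    element C C-cyclicFlat = C , [ Equivalence.from (cyclicFlats C) C-cyclicFlat ]

    f-strict : ∀ (Z : Element) → value Z ⊂ A → f (value Z) < f A
    f-strict Z = proj₁ (cyclicFlat Z) _

  f≤rank+μ : ∀ A (Z : Element) → f A ≤ rank Z + μ (A ─ value Z)
  f≤rank+μ A Z =
    ≤-trans (f≤f+μ A (value Z)) (+-monoˡ-≤ _ (≤-reflexive (sym (rank≈ Z))))

  -- Together with `f≤rank+μ` this expresses `f A` through `rank` and `μ` alone, which is what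
  -- uniqueness and integrality rest on.
  rank+μ≤f : ∀ A → ∃ λ (Z : Element) → rank Z + μ (A ─ value Z) ≤ f A
  rank+μ≤f A =
    let C , C-cyclicFlat , f+μ≤f , _ = decomposition A
        Z = element C C-cyclicFlat
    in Z , ≤-trans (+-monoˡ-≤ _ (≤-reflexive (rank≈ Z))) f+μ≤f

  private
    -- The cyclic flat in the decomposition of `⊥` has value at most zero, and `O` lies below it.
    f-O : f (value O) ≈ 0#
    f-O = let C , C-cyclicFlat , f+μ≤f , _ = decomposition ⊥ in ≤-antisym
      (begin
        f (value O)      ≤⟨ f-mono (O-minimum (element C C-cyclicFlat)) ⟩
        f C              ≤⟨ x≤x+y (Measure.nonneg M _) ⟩
        f C + μ (⊥ ─ C)  ≤⟨ f+μ≤f ⟩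
        f ⊥              ≈⟨ empty ⟩
        0#               ∎)
      (f-nonneg _)

  -- Some `i` lies in `Z₂` but not in `Z₁`. Cyclicity of `Z₂` makes the loss of `i` cost strictly
  -- less than `μ ⁅ i ⁆`, and what remains is bounded by `rank Z₁` plus a measure.
  rank-<-μ : ∀ (Z₁ Z₂ : Element) → value Z₁ ⊂ value Z₂ →
             rank Z₂ < μ (value Z₂ ─ value Z₁) + rank Z₁
  rank-<-μ Z₁ Z₂ (Z₁⊆Z₂ , i , i∈Z₂ , i∉Z₁) with proj₂ (cyclicFlat Z₂) i i∈Z₂
  -- A loop outside `Z₁` could be added to it without raising `f`, so `Z₁` would not be a flat.
  ... | inj₁ fi≈0 = contradiction
    (begin
      f (value Z₁ ∪ ⁅ i ⁆)     ≤⟨ f-subadditive id ⟩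
      f (value Z₁) + f ⁅ i ⁆   ≈⟨ +-congˡ fi≈0 ⟩
      f (value Z₁) + 0#        ≈⟨ +-identityʳ _ ⟩
      f (value Z₁)             ∎)
    (<⇒≱ (f-strict Z₁ (⊂-insert i∉Z₁)))
  ... | inj₂ <fi = begin-strict
    rank Z₂                                 ≈⟨ rank≈ Z₂ ⟩
    f (value Z₂)                            <⟨ x-y<z⇒x<z+y <fi ⟩
    f ⁅ i ⁆ + f Z₂′                         ≈⟨ +-congʳ (sym (measure≈ i)) ⟩
    μ ⁅ i ⁆ + f Z₂′                         ≤⟨ +-monoʳ-≤ _ (f≤rank+μ Z₂′ Z₁) ⟩
    μ ⁅ i ⁆ + (rank Z₁ + μ (Z₂′ ─ value Z₁))
      ≈⟨ solve 3 (λ a b c → (a ⊕ (b ⊕ c)) ⊜ ((a ⊕ c) ⊕ b)) refl _ _ _ ⟩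
    μ ⁅ i ⁆ + μ (Z₂′ ─ value Z₁) + rank Z₁
      ≤⟨ +-monoˡ-≤ _ (μ-superadditive
           (⁅⁆⊆ (x∈p∧x∉q⇒x∈p─q i∈Z₂ i∉Z₁)) (─-mono (p─q⊆p (value Z₂) _) id)
           λ a∈i a∈Z₂′ → proj₂ (∈-─⁻ (proj₁ (∈-─⁻ a∈Z₂′))) a∈i) ⟩
    μ (value Z₂ ─ value Z₁) + rank Z₁       ∎
    where
    open +-Solver using (solve; _⊜_; _⊕_)
    Z₂′ = value Z₂ ─ ⁅ i ⁆

  -- The cyclic flat found for the union contains both members, hence their join, and its value is
  -- at most that of the union.
  rank-∨ : ∀ Z₁ Z₂ → rank (Z₁ ∨ Z₂) ≤ f (value Z₁ ∪ value Z₂)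
  rank-∨ Z₁ Z₂ =
    let C , C-cyclicFlat , f+μ≤f , C-greatest , _ =
          decomposition (value Z₁ ∪ value Z₂)
    in begin
    rank (Z₁ ∨ Z₂)       ≈⟨ rank≈ (Z₁ ∨ Z₂) ⟩
    f (value (Z₁ ∨ Z₂))  ≤⟨ f-mono (∨-least {Z₁} {Z₂} {element C C-cyclicFlat}
                              (C-greatest _ (cyclicFlat Z₁) (p⊆p∪q _))
                              (C-greatest _ (cyclicFlat Z₂) (q⊆p∪q _ _))) ⟩
    f C                  ≤⟨ x≤x+y (Measure.nonneg M _) ⟩
    f C + μ _            ≤⟨ f+μ≤f ⟩
    f (value Z₁ ∪ value Z₂)  ∎

  -- The cyclic flat `C` found for the intersection lies in both flats, hence below their meet `K`.
  -- The measures of the disjoint sets `K ─ C` and `I ─ K` then fit into that of `I ─ C`.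
  rank-∧ : ∀ Z₁ Z₂ →
           rank (Z₁ ∧ Z₂) + μ ((value Z₁ ∩ value Z₂) ─ value (Z₁ ∧ Z₂)) ≤
           f (value Z₁ ∩ value Z₂)
  rank-∧ Z₁ Z₂ =
    let C , C-cyclicFlat , f+μ≤f , _ , C-least = decomposition I
        C⊆K : C ⊆ K
        C⊆K = ∧-greatest {element C C-cyclicFlat} {Z₁} {Z₂}
          (C-least _ (proj₁ (cyclicFlat Z₁)) (p∩q⊆p _ _))
          (C-least _ (proj₁ (cyclicFlat Z₂)) (p∩q⊆q _ _))
    in begin
    rank (Z₁ ∧ Z₂) + μ (I ─ K)
      ≤⟨ +-monoˡ-≤ _ (≤-trans (≤-reflexive (rank≈ (Z₁ ∧ Z₂))) (f≤f+μ K C)) ⟩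
    f C + μ (K ─ C) + μ (I ─ K)
      ≈⟨ +-assoc _ _ _ ⟩
    f C + (μ (K ─ C) + μ (I ─ K))
      ≤⟨ +-monoʳ-≤ _ (μ-superadditive (─-mono K⊆I id) (─-mono id C⊆K)
           λ a∈K─C a∈I─K → proj₂ (∈-─⁻ a∈I─K) (proj₁ (∈-─⁻ a∈K─C))) ⟩
    f C + μ (I ─ C)
      ≤⟨ f+μ≤f ⟩
    f I  ∎
    where
    I = value Z₁ ∩ value Z₂
    K = value (Z₁ ∧ Z₂)
    K⊆I : K ⊆ I
    K⊆I = ∩-greatest (x∧y≤x Z₁ Z₂) (x∧y≤y Z₁ Z₂)

  cyclicFlatAxioms : CyclicFlatAxioms ℝ Λ M
  cyclicFlatAxioms = record
    { rank-O          = rank-O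
    ; rank-strict     = λ Z₁ Z₂ Z₁⊂Z₂ →
        x<y⇒0<y-x (rank-< Z₁ Z₂ Z₁⊂Z₂) , x<z+y⇒x-y<z (rank-<-μ Z₁ Z₂ Z₁⊂Z₂)
    ; rank-submodular = rank-submodular
    ; measure≤rank    = λ a Z a∈Z → begin
        μ ⁅ a ⁆      ≈⟨ measure≈ a ⟩
        f ⁅ a ⁆      ≤⟨ f-mono (⁅⁆⊆ a∈Z) ⟩
        f (value Z)  ≈⟨ rank≈ Z ⟨
        rank Z       ∎
    ; rank-pos        = λ Z Z≢O → begin-strict
        0#      ≈⟨ rank-O ⟨
        rank O  <⟨ rank-< O Z (⊆∧⊉⇒⊂ (O-minimum Z)
                     (λ Z⊆O → Z≢O (⊆-antisym Z⊆O (O-minimum Z)))) ⟩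
        rank Z  ∎
    ; measure-pos     = λ a a∉O → begin-strict
        0#                     ≈⟨ f-O ⟨
        f (value O)            <⟨ f-strict O (⊂-insert a∉O) ⟩
        f (value O ∪ ⁅ a ⁆)    ≤⟨ f-subadditive id ⟩
        f (value O) + f ⁅ a ⁆  ≈⟨ +-cong f-O (sym (measure≈ a)) ⟩
        0# + μ ⁅ a ⁆           ≈⟨ +-identityˡ _ ⟩
        μ ⁅ a ⁆                ∎
    }
    where
    rank-O : rank O ≈ 0#
    rank-O = trans (rank≈ O) f-O

    rank-< : ∀ (Z₁ Z₂ : Element) → value Z₁ ⊂ value Z₂ → rank Z₁ < rank Z₂
    rank-< Z₁ Z₂ Z₁⊂Z₂ = begin-strict
      rank Z₁       ≈⟨ rank≈ Z₁ ⟩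
      f (value Z₁)  <⟨ f-strict Z₁ Z₁⊂Z₂ ⟩
      f (value Z₂)  ≈⟨ rank≈ Z₂ ⟨
      rank Z₂       ∎

    rank-submodular : ∀ (Z₁ Z₂ : Element) →
      rank (Z₁ ∨ Z₂) + rank (Z₁ ∧ Z₂)
        + μ ((value Z₁ ∩ value Z₂) ─ value (Z₁ ∧ Z₂)) ≤ rank Z₁ + rank Z₂
    rank-submodular Z₁ Z₂ = begin
      rank (Z₁ ∨ Z₂) + rank (Z₁ ∧ Z₂) + μ _
        ≈⟨ +-assoc _ _ _ ⟩
      rank (Z₁ ∨ Z₂) + (rank (Z₁ ∧ Z₂) + μ _)
        ≤⟨ +-mono-≤ (rank-∨ Z₁ Z₂) (rank-∧ Z₁ Z₂) ⟩
      f (value Z₁ ∪ value Z₂) + f (value Z₁ ∩ value Z₂)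
        ≤⟨ f-submodular id id ⟩
      f (value Z₁) + f (value Z₂)
        ≈⟨ +-cong (rank≈ Z₁) (rank≈ Z₂) ⟨
      rank Z₁ + rank Z₂  ∎

  integerValued⇔ : IntegerValued ℝ f ⇔ (IntegerValued ℝ rank × IntegerValued ℝ μ)
  integerValued⇔ = mk⇔
    (λ f∈ℤ → (λ Z → IsInteger-resp-≈ (sym (rank≈ Z)) (f∈ℤ (value Z))) ,
             IntegerValued-μ (λ a → IsInteger-resp-≈ (sym (measure≈ a)) (f∈ℤ ⁅ a ⁆)))
    (λ (rank∈ℤ , μ∈ℤ) A → let (Z , rank+μ≤fA) = rank+μ≤f A in
      IsInteger-resp-≈ (≤-antisym rank+μ≤fA (f≤rank+μ A Z))
        (IsInteger-+ (rank∈ℤ Z) (μ∈ℤ (A ─ value Z))))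

-- From the axioms to a polymatroid: the minimum of the bounds.

module Sufficiency
  (ℝ : CompleteOrderedField c ℓ₁ ℓ₂) (Λ : RankedLattice ℝ n p) (M : Measure ℝ n)
  (axioms : CyclicFlatAxioms ℝ Λ M) where

  open OrderedField ℝ
  open MeasureProperties ℝ M
  open RankedLattice Λ
    using (Member; member?; Element; _∨_; _∧_; O; O-minimum; rank; isLattice)
    renaming (nonneg to rank-nonneg)
  open IsLattice isLattice using (x≤x∨y; y≤x∨y; x∧y≤x; x∧y≤y)
  open Measure M using (μ) renaming (nonneg to μ-nonneg)
  open CyclicFlatAxioms axioms
  open +-Solver using (solve; _⊜_; _⊕_)
  open ≤-Reasoning

  bound : Subset n → Element → Carrier
  bound A Z = rank Z + μ (A ─ value Z)

  private
    element : (Z : Subset n) → Dec (Member Z) → Element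
    element Z (yes Z∈L) = Z , [ Z∈L ]
    -- The default `O` is itself a member, so the minimum over all subsets is the minimum over the
    -- lattice.
    element Z (no _)    = O

    element-value : (Z : Element) (d : Dec (Member (value Z))) →
                    element (value Z) d ≡ Z
    element-value Z             (yes _)  = ≡.refl
    element-value (_ , [ Z∈L ]) (no Z∉L) = contradiction-irr Z∈L Z∉L

    best : ∀ A → ∃ λ Y → ∀ Z → bound A Y ≤ bound A Z
    best A =
      let Y , Y≤ = minimizer (bound A) (λ Z → element Z (member? Z))
      in element Y (member? Y) , λ Z →
        ≡.subst (λ Z′ → _ ≤ bound A Z′) (element-value Z (member? (value Z)))
          (Y≤ (value Z))

  minimalBound : SetFunction ℝ n
  minimalBound A = bound A (proj₁ (best A))

  private
    f : SetFunction ℝ n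
    f = minimalBound

  f≤bound : ∀ A Z → f A ≤ bound A Z
  f≤bound A = proj₂ (best A)

  bound-mono : A ⊆ B → ∀ Z → bound A Z ≤ bound B Z
  bound-mono A⊆B Z = +-monoʳ-≤ _ (μ-mono (─-mono A⊆B id))

  rank-< : ∀ {Y Z : Element} → value Y ⊂ value Z → rank Y < rank Z
  rank-< {Y} {Z} Y⊂Z = 0<y-x⇒x<y (proj₁ (rank-strict Y Z Y⊂Z))

  rank-mono : ∀ {Y Z : Element} → value Y ⊆ value Z → rank Y ≤ rank Z
  rank-mono {Y} {Z} Y⊆Z with value Z ⊆? value Y
  ... | no  Z⊈Y = <⇒≤ (rank-< {Y} {Z} (⊆∧⊉⇒⊂ Y⊆Z Z⊈Y))
  ... | yes Z⊆Y with ≡.refl ← ⊆-antisym Y⊆Z Z⊆Y = ≤-refl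

  -- The upper half of `rank-strict`, weakened so as to include `Y` equal to `Z`.
  rank-lipschitz : ∀ {Y Z : Element} → value Y ⊆ value Z →
                   rank Z ≤ bound (value Z) Y
  rank-lipschitz {Y} {Z} Y⊆Z with value Z ⊆? value Y
  ... | no Z⊈Y = begin
    rank Z                          <⟨ x-y<z⇒x<z+y (proj₂ (rank-strict Y Z (⊆∧⊉⇒⊂ Y⊆Z Z⊈Y))) ⟩
    μ (value Z ─ value Y) + rank Y  ≈⟨ +-comm _ _ ⟩
    rank Y + μ (value Z ─ value Y)  ∎
  ... | yes Z⊆Y = ≤-trans (rank-mono {Z} {Y} Z⊆Y) (x≤x+y (μ-nonneg _))

  -- A point of `Z` outside the meet is either in `I ─ K`, which is paid for by the measure term of
  -- `rank-submodular`, or outside `Y`. This trades `Y` for a member included in `Z`.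
  bound-∧ : ∀ Y Z → rank (Z ∨ Y) + bound (value Z) (Z ∧ Y) ≤
                    rank Z + bound (value Z) Y
  bound-∧ Y Z = begin
    rank (Z ∨ Y) + (rank (Z ∧ Y) + μ (value Z ─ K))
      ≤⟨ +-monoʳ-≤ _ (+-monoʳ-≤ _ (μ-subadditive Z─K⊆)) ⟩
    rank (Z ∨ Y) + (rank (Z ∧ Y) + (μ (I ─ K) + μ (value Z ─ value Y)))
      ≈⟨ solve 4 (λ a b c d → (a ⊕ (b ⊕ (c ⊕ d))) ⊜ (((a ⊕ b) ⊕ c) ⊕ d))
           refl _ _ _ _ ⟩
    rank (Z ∨ Y) + rank (Z ∧ Y) + μ (I ─ K) + μ (value Z ─ value Y)
      ≤⟨ +-monoˡ-≤ _ (rank-submodular Z Y) ⟩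
    rank Z + rank Y + μ (value Z ─ value Y)
      ≈⟨ +-assoc _ _ _ ⟩
    rank Z + (rank Y + μ (value Z ─ value Y))  ∎
    where
    I = value Z ∩ value Y
    K = value (Z ∧ Y)
    Z─K⊆ : value Z ─ K ⊆ (I ─ K) ∪ (value Z ─ value Y)
    Z─K⊆ {x} x∈Z─K with ∈-─⁻ x∈Z─K | x ∈? value Y
    ... | x∈Z , x∉K | yes x∈Y = p⊆p∪q _ (x∈p∧x∉q⇒x∈p─q (x∈p∩q⁺ (x∈Z , x∈Y)) x∉K)
    ... | x∈Z , x∉K | no  x∉Y = q⊆p∪q _ _ (x∈p∧x∉q⇒x∈p─q x∈Z x∉Y)

  -- After the trade of `bound-∧`, the join has rank at least `rank Z`, and the meet, being inside
  -- `Z`, satisfies `rank-lipschitz`.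
  bound-lower : ∀ Y Z → rank Z ≤ bound (value Z) Y
  bound-lower Y Z = +-cancelʳ-≤ (rank Z) (begin
    rank Z + rank Z                         ≤⟨ +-mono-≤ (rank-mono {Z} {Z ∨ Y} (x≤x∨y Z Y))
                                                 (rank-lipschitz {Z ∧ Y} {Z} (x∧y≤x Z Y)) ⟩
    rank (Z ∨ Y) + bound (value Z) (Z ∧ Y)  ≤⟨ bound-∧ Y Z ⟩
    rank Z + bound (value Z) Y              ≈⟨ +-comm _ _ ⟩
    bound (value Z) Y + rank Z              ∎)

  -- Now the join is strictly above `Z`, so the rank of the join gives the strictness.
  bound-lower-⊈ : ∀ Y Z → ¬ value Y ⊆ value Z → rank Z < bound (value Z) Y
  bound-lower-⊈ Y Z Y⊈Z = +-cancelʳ-< (rank Z) (begin-strict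
    rank Z + rank Z                         <⟨ +-monoˡ-< _ (rank-< {Z} {Z ∨ Y} Z⊂Z∨Y) ⟩
    rank (Z ∨ Y) + rank Z                   ≤⟨ +-monoʳ-≤ _ (rank-lipschitz {Z ∧ Y} {Z} (x∧y≤x Z Y)) ⟩
    rank (Z ∨ Y) + bound (value Z) (Z ∧ Y)  ≤⟨ bound-∧ Y Z ⟩
    rank Z + bound (value Z) Y              ≈⟨ +-comm _ _ ⟩
    bound (value Z) Y + rank Z              ∎)
    where
    Z⊂Z∨Y : value Z ⊂ value (Z ∨ Y)
    Z⊂Z∨Y = ⊆∧⊉⇒⊂ (x≤x∨y Z Y) (λ Z∨Y⊆Z → Y⊈Z (Z∨Y⊆Z ∘ y≤x∨y Z Y))

  -- Now the meet misses `i` and is strictly below `Z`, so the strictness comes from the upper half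
  -- of `rank-strict`.
  bound-lower-∉ : ∀ {i} Y Z → i ∈ value Z → i ∉ value Y →
                  rank Z < bound (value Z) Y
  bound-lower-∉ {i} Y Z i∈Z i∉Y = +-cancelʳ-< (rank Z) (begin-strict
    rank Z + rank Z                         ≤⟨ +-monoˡ-≤ _ (rank-mono {Z} {Z ∨ Y} (x≤x∨y Z Y)) ⟩
    rank (Z ∨ Y) + rank Z                   <⟨ +-monoʳ-< _ (x-y<z⇒x<z+y
                                                 (proj₂ (rank-strict (Z ∧ Y) Z Z∧Y⊂Z))) ⟩
    rank (Z ∨ Y) + (μ _ + rank (Z ∧ Y))     ≈⟨ +-congˡ (+-comm _ _) ⟩
    rank (Z ∨ Y) + bound (value Z) (Z ∧ Y)  ≤⟨ bound-∧ Y Z ⟩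
    rank Z + bound (value Z) Y              ≈⟨ +-comm _ _ ⟩
    bound (value Z) Y + rank Z              ∎)
    where
    Z∧Y⊂Z : value (Z ∧ Y) ⊂ value Z
    Z∧Y⊂Z = x∧y≤x Z Y , i , i∈Z , i∉Y ∘ x∧y≤y Z Y

  -- Agreement with rank and measure, and submodularity.

  bound-self : ∀ {A} Z → A ⊆ value Z → bound A Z ≈ rank Z
  bound-self Z A⊆Z = trans
    (+-congˡ (μ-empty λ a a∈A─Z → let (a∈A , a∉Z) = ∈-─⁻ a∈A─Z in a∉Z (A⊆Z a∈A)))
    (+-identityʳ _)

  rank≈f : ∀ Z → rank Z ≈ f (value Z)
  rank≈f Z = ≤-antisym (bound-lower _ Z)
    (≤-trans (f≤bound (value Z) Z) (≤-reflexive (bound-self Z id)))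

  μ≈f : ∀ a → μ ⁅ a ⁆ ≈ f ⁅ a ⁆
  μ≈f a = ≤-antisym (μ≤bound (proj₁ (best ⁅ a ⁆))) (begin
    f ⁅ a ⁆                      ≤⟨ f≤bound ⁅ a ⁆ O ⟩
    rank O + μ (⁅ a ⁆ ─ value O)  ≈⟨ +-congʳ rank-O ⟩
    0# + μ (⁅ a ⁆ ─ value O)      ≈⟨ +-identityˡ _ ⟩
    μ (⁅ a ⁆ ─ value O)           ≤⟨ μ-mono (p─q⊆p ⁅ a ⁆ _) ⟩
    μ ⁅ a ⁆                       ∎)
    where
    μ≤bound : ∀ Y → μ ⁅ a ⁆ ≤ bound ⁅ a ⁆ Y
    -- The point `a` is paid for by `rank Y` if it lies in `Y`, and by the measure term otherwise.
    μ≤bound Y with a ∈? value Y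
    ... | yes a∈Y = ≤-trans (measure≤rank a Y a∈Y) (x≤x+y (μ-nonneg _))
    ... | no  a∉Y = ≤-trans
      (μ-mono (⁅⁆⊆ (x∈p∧x∉q⇒x∈p─q (x∈⁅x⁆ a) a∉Y))) (y≤x+y (rank-nonneg Y))

  -- The join is tried for the union and the meet for the intersection. The extra measure this costs
  -- is at most `μ R`, the term that `rank-submodular` supplies.
  bound-∪∩ : ∀ A B Y Z →
    bound (A ∪ B) (Y ∨ Z) + bound (A ∩ B) (Y ∧ Z) ≤ bound A Y + bound B Z
  bound-∪∩ A B Y Z = begin
    rank (Y ∨ Z) + μ S + (rank (Y ∧ Z) + μ T)
      ≈⟨ solve 4 (λ a b c d → ((a ⊕ b) ⊕ (c ⊕ d)) ⊜ ((a ⊕ c) ⊕ (b ⊕ d)))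
           refl _ _ _ _ ⟩
    rank (Y ∨ Z) + rank (Y ∧ Z) + (μ S + μ T)
      ≤⟨ +-monoʳ-≤ _ μS+μT≤ ⟩
    rank (Y ∨ Z) + rank (Y ∧ Z) + (μ R + (μ P + μ Q))
      ≈⟨ +-assoc _ _ _ ⟨
    rank (Y ∨ Z) + rank (Y ∧ Z) + μ R + (μ P + μ Q)
      ≤⟨ +-monoˡ-≤ _ (rank-submodular Y Z) ⟩
    rank Y + rank Z + (μ P + μ Q)
      ≈⟨ solve 4 (λ a b c d → ((a ⊕ b) ⊕ (c ⊕ d)) ⊜ ((a ⊕ c) ⊕ (b ⊕ d)))
           refl _ _ _ _ ⟩
    rank Y + μ P + (rank Z + μ Q)  ∎
    where
    S = (A ∪ B) ─ value (Y ∨ Z)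
    T = (A ∩ B) ─ value (Y ∧ Z)
    P = A ─ value Y
    Q = B ─ value Z
    R = (value Y ∩ value Z) ─ value (Y ∧ Z)

    S∪T⊆ : S ∪ T ⊆ R ∪ (P ∪ Q)
    S∪T⊆ {x} x∈ with x ∈? value Y | x ∈? value Z | x∈p∪q⁻ S T x∈
    ... | yes x∈Y | _       | inj₁ x∈S =
      contradiction (x≤x∨y Y Z x∈Y) (proj₂ (∈-─⁻ x∈S))
    ... | no  x∉Y | yes x∈Z | inj₁ x∈S =
      contradiction (y≤x∨y Y Z x∈Z) (proj₂ (∈-─⁻ x∈S))
    ... | no  x∉Y | no  x∉Z | inj₁ x∈S = q⊆p∪q _ _
      ([ (λ x∈A → p⊆p∪q _ (x∈p∧x∉q⇒x∈p─q x∈A x∉Y))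
       , (λ x∈B → q⊆p∪q _ _ (x∈p∧x∉q⇒x∈p─q x∈B x∉Z)) ]′
       (x∈p∪q⁻ A B (proj₁ (∈-─⁻ x∈S))))
    ... | yes x∈Y | yes x∈Z | inj₂ x∈T =
      p⊆p∪q _ (x∈p∧x∉q⇒x∈p─q (x∈p∩q⁺ (x∈Y , x∈Z)) (proj₂ (∈-─⁻ x∈T)))
    ... | no  x∉Y | _       | inj₂ x∈T = q⊆p∪q _ _
      (p⊆p∪q _ (x∈p∧x∉q⇒x∈p─q (p∩q⊆p A B (proj₁ (∈-─⁻ x∈T))) x∉Y))
    ... | yes x∈Y | no  x∉Z | inj₂ x∈T = q⊆p∪q _ _
      (q⊆p∪q _ _ (x∈p∧x∉q⇒x∈p─q (p∩q⊆q A B (proj₁ (∈-─⁻ x∈T))) x∉Z))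

    S∩T⊆ : S ∩ T ⊆ P ∩ Q
    S∩T⊆ x∈ with x∈p∩q⁻ S T x∈
    ... | x∈S , x∈T with ∈-─⁻ x∈S | x∈p∩q⁻ A B (proj₁ (∈-─⁻ x∈T))
    ... | _ , x∉Y∨Z | x∈A , x∈B = x∈p∩q⁺
      ( x∈p∧x∉q⇒x∈p─q x∈A (x∉Y∨Z ∘ x≤x∨y Y Z)
      , x∈p∧x∉q⇒x∈p─q x∈B (x∉Y∨Z ∘ y≤x∨y Y Z))

    -- Points lying in both `S` and `T` lie in both `P` and `Q`, so modularity accounts for them
    -- twice on each side.
    μS+μT≤ : μ S + μ T ≤ μ R + (μ P + μ Q)
    μS+μT≤ = begin
      μ S + μ T                      ≈⟨ μ-modular S T ⟨
      μ (S ∪ T) + μ (S ∩ T)          ≤⟨ +-mono-≤ (μ-subadditive S∪T⊆) (μ-mono S∩T⊆) ⟩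
      μ R + μ (P ∪ Q) + μ (P ∩ Q)    ≈⟨ +-assoc _ _ _ ⟩
      μ R + (μ (P ∪ Q) + μ (P ∩ Q))  ≈⟨ +-congˡ (μ-modular P Q) ⟩
      μ R + (μ P + μ Q)              ∎

  isPolymatroid : IsPolymatroid ℝ f
  isPolymatroid = record
    { empty      = ≤-antisym
        (≤-trans (f≤bound ⊥ O) (≤-reflexive (trans (bound-self O ⊥⊆) rank-O)))
        (f-nonneg ⊥)
    ; nonneg     = f-nonneg
    ; monotone   = λ A B A⊆B →
        ≤-trans (f≤bound A _) (bound-mono A⊆B (proj₁ (best B)))
    ; submodular = λ A B → ≤-trans
        (+-mono-≤ (f≤bound (A ∪ B) _) (f≤bound (A ∩ B) _))
        (bound-∪∩ A B (proj₁ (best A)) (proj₁ (best B)))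
    }
    where
    f-nonneg : ∀ A → 0# ≤ f A
    f-nonneg A = ≤-trans (rank-nonneg _) (x≤x+y (μ-nonneg _))

  -- The members are exactly the cyclic flats.

  member⇒flat : ∀ Z → IsFlat ℝ f (value Z)
  member⇒flat Z F (Z⊆F , a , a∈F , a∉Z) = begin-strict
    f (value Z)  ≈⟨ rank≈f Z ⟨
    rank Z       <⟨ rank<bound (proj₁ (best F)) ⟩
    f F          ∎
    where
    -- If `Y` is not inside `Z`, the bound is already strict on `Z`. If it is, then `a` is outside
    -- `Y` and adds `μ ⁅ a ⁆`, which is positive because `a` is also outside `O`.
    rank<bound : ∀ Y → rank Z < bound F Y
    rank<bound Y with value Y ⊆? value Z
    ... | no  Y⊈Z = begin-strict
      rank Z             <⟨ bound-lower-⊈ Y Z Y⊈Z ⟩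
      bound (value Z) Y  ≤⟨ bound-mono Z⊆F Y ⟩
      bound F Y          ∎
    ... | yes Y⊆Z = begin-strict
      rank Z                                     ≤⟨ bound-lower Y Z ⟩
      rank Y + μ (value Z ─ value Y)             <⟨ x<x+y (measure-pos a (a∉Z ∘ O-minimum Z)) ⟩
      rank Y + μ (value Z ─ value Y) + μ ⁅ a ⁆   ≈⟨ +-assoc _ _ _ ⟩
      rank Y + (μ (value Z ─ value Y) + μ ⁅ a ⁆)
        ≤⟨ +-monoʳ-≤ _ (μ-superadditive (─-mono Z⊆F id)
             (⁅⁆⊆ (x∈p∧x∉q⇒x∈p─q a∈F (a∉Z ∘ Y⊆Z)))
             λ b∈Z─Y b∈a → a∉Z (≡.subst (_∈ value Z) (x∈⁅y⁆⇒x≡y a b∈a)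
                                  (proj₁ (∈-─⁻ b∈Z─Y)))) ⟩
      bound F Y                                  ∎

  bound-insert : ∀ {i} A Y → i ∈ A → i ∉ value Y →
                 μ ⁅ i ⁆ + bound (A ─ ⁅ i ⁆) Y ≤ bound A Y
  bound-insert {i} A Y i∈A i∉Y = begin
    μ ⁅ i ⁆ + (rank Y + μ (A′ ─ value Y))
      ≈⟨ solve 3 (λ a b c → (a ⊕ (b ⊕ c)) ⊜ (b ⊕ (a ⊕ c))) refl _ _ _ ⟩
    rank Y + (μ ⁅ i ⁆ + μ (A′ ─ value Y))
      ≤⟨ +-monoʳ-≤ _ (μ-superadditive (⁅⁆⊆ (x∈p∧x∉q⇒x∈p─q i∈A i∉Y))
           (─-mono (p─q⊆p A _) id)
           λ a∈i a∈A′─Y → proj₂ (∈-─⁻ (proj₁ (∈-─⁻ a∈A′─Y))) a∈i) ⟩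
    rank Y + μ (A ─ value Y)  ∎
    where A′ = A ─ ⁅ i ⁆

  member⇒cyclic : ∀ Z i → i ∈ value Z →
                  f ⁅ i ⁆ ≈ 0# ⊎ f (value Z) - f (value Z ─ ⁅ i ⁆) < f ⁅ i ⁆
  member⇒cyclic Z i i∈Z with i ∈? value O
  -- A point of `O` is a loop, since its measure is at most `rank O`.
  ... | yes i∈O = inj₁ (trans (sym (μ≈f i)) (≤-antisym
    (≤-trans (measure≤rank i O i∈O) (≤-reflexive rank-O)) (μ-nonneg _)))
  ... | no  i∉O = inj₂ (x<z+y⇒x-y<z (begin-strict
    f (value Z)     ≈⟨ rank≈f Z ⟨
    rank Z          <⟨ rank<μ+bound (proj₁ (best Z′)) ⟩
    μ ⁅ i ⁆ + f Z′  ≈⟨ +-congʳ (μ≈f i) ⟩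
    f ⁅ i ⁆ + f Z′  ∎))
    where
    Z′ = value Z ─ ⁅ i ⁆

    -- If `i` is in `Y`, deleting it from `Z` leaves the bound as it was, and `μ ⁅ i ⁆` is a
    -- positive surplus. Otherwise `i` shows that `Z` is not inside `Y`, and `bound-lower-∉` is
    -- strict.
    rank<μ+bound : ∀ Y → rank Z < μ ⁅ i ⁆ + bound Z′ Y
    rank<μ+bound Y with i ∈? value Y
    ... | yes i∈Y = begin-strict
      rank Z                ≤⟨ bound-lower Y Z ⟩
      bound (value Z) Y     ≤⟨ +-monoʳ-≤ _ (μ-mono Z─Y⊆) ⟩
      bound Z′ Y            <⟨ x<x+y (measure-pos i i∉O) ⟩
      bound Z′ Y + μ ⁅ i ⁆  ≈⟨ +-comm _ _ ⟩
      μ ⁅ i ⁆ + bound Z′ Y  ∎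
      where
      Z─Y⊆ : value Z ─ value Y ⊆ Z′ ─ value Y
      Z─Y⊆ x∈ = let (x∈Z , x∉Y) = ∈-─⁻ x∈ in
        x∈p∧x∉q⇒x∈p─q (x∈p∧x∉q⇒x∈p─q x∈Z (x∉Y ∘ ⁅⁆⊆ i∈Y)) x∉Y
    ... | no  i∉Y = begin-strict
      rank Z
        <⟨ bound-lower-∉ Y Z i∈Z i∉Y ⟩
      rank Y + μ (value Z ─ value Y)
        ≤⟨ +-monoʳ-≤ _ (μ-subadditive Z─Y⊆) ⟩
      rank Y + (μ ⁅ i ⁆ + μ (Z′ ─ value Y))
        ≈⟨ solve 3 (λ a b c → (b ⊕ (a ⊕ c)) ⊜ (a ⊕ (b ⊕ c))) refl _ _ _ ⟩
      μ ⁅ i ⁆ + bound Z′ Y  ∎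
      where
      Z─Y⊆ : value Z ─ value Y ⊆ ⁅ i ⁆ ∪ (Z′ ─ value Y)
      Z─Y⊆ {x} x∈ with ∈-─⁻ x∈ | x ∈? ⁅ i ⁆
      ... | _         | yes x∈i = p⊆p∪q _ x∈i
      ... | x∈Z , x∉Y | no  x∉i =
        q⊆p∪q _ _ (x∈p∧x∉q⇒x∈p─q (x∈p∧x∉q⇒x∈p─q x∈Z x∉i) x∉Y)

  -- A minimiser `Y` for `C` must be `C` itself: flatness gives `Y⊆C` and cyclicity gives `C⊆Y`.
  cyclicFlat⇒member : ∀ C → IsCyclicFlat ℝ f C → Member C
  cyclicFlat⇒member C (C-flat , C-cyclic) = member (best C)
    where
    member : (∃ λ Y → ∀ Z → bound C Y ≤ bound C Z) → Member C
    member (Y , Y-best) = equal Y (⊆-antisym Y⊆C C⊆Y)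
      where
      equal : ∀ (Y : Element) → value Y ≡ C → Member C
      equal (_ , [ C∈L ]) ≡.refl = recompute (member? C) C∈L

      boundC≤f : bound C Y ≤ f C
      boundC≤f = Y-best (proj₁ (best C))

      Y⊆C : value Y ⊆ C
      -- Adding `Y` to `C` leaves the bound at `Y` no larger, so a flat `C` already contains it.
      Y⊆C = decidable-stable (value Y ⊆? C) λ Y⊈C → <⇒≱
        (C-flat (C ∪ value Y) (⊆∧⊉⇒⊂ (p⊆p∪q _) (λ ⊆C → Y⊈C (⊆C ∘ q⊆p∪q C _))))
        (begin
          f (C ∪ value Y)        ≤⟨ f≤bound _ Y ⟩
          bound (C ∪ value Y) Y  ≤⟨ +-monoʳ-≤ _ (μ-mono C∪Y─Y⊆) ⟩
          bound C Y              ≤⟨ boundC≤f ⟩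
          f C                    ∎)
        where
        C∪Y─Y⊆ : (C ∪ value Y) ─ value Y ⊆ C ─ value Y
        C∪Y─Y⊆ x∈ with ∈-─⁻ x∈
        ... | x∈C∪Y , x∉Y with x∈p∪q⁻ C _ x∈C∪Y
        ... | inj₁ x∈C = x∈p∧x∉q⇒x∈p─q x∈C x∉Y
        ... | inj₂ x∈Y = contradiction x∈Y x∉Y

      C⊆Y : C ⊆ value Y
      -- A point of `C` outside `Y` has positive measure and, by `bound-insert`, contributes all of
      -- it to `f C`; neither alternative of cyclicity allows this.
      C⊆Y {i} i∈C = decidable-stable (i ∈? value Y) λ i∉Y →
        ∉Y-impossible i i∈C i∉Y (C-cyclic i i∈C)
        where
        ∉Y-impossible : ∀ i → i ∈ C → i ∉ value Y →
                        ¬ (f ⁅ i ⁆ ≈ 0# ⊎ f C - f (C ─ ⁅ i ⁆) < f ⁅ i ⁆)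
        ∉Y-impossible i i∈C i∉Y (inj₁ fi≈0) = <⇒≱ (measure-pos i (i∉Y ∘ O-minimum Y))
          (≤-reflexive (trans (μ≈f i) fi≈0))
        ∉Y-impossible i i∈C i∉Y (inj₂ <fi) = <⇒≱ (x-y<z⇒x<z+y <fi) (begin
          f ⁅ i ⁆ + f (C ─ ⁅ i ⁆)        ≤⟨ +-mono-≤ (≤-reflexive (sym (μ≈f i)))
                                                   (f≤bound _ Y) ⟩
          μ ⁅ i ⁆ + bound (C ─ ⁅ i ⁆) Y  ≤⟨ bound-insert C Y i∈C i∉Y ⟩
          bound C Y                      ≤⟨ boundC≤f ⟩
          f C                            ∎)

  realizes : Realizes ℝ Λ M minimalBound
  realizes = record
    { isPolymatroid = isPolymatroid
    ; cyclicFlats   = λ Z → mk⇔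
        (λ Z∈L → member⇒flat (Z , [ Z∈L ]) , member⇒cyclic (Z , [ Z∈L ]))
        (cyclicFlat⇒member Z)
    ; rank≈         = rank≈f
    ; measure≈      = μ≈f
    }

-- Uniqueness and the equivalence.

realizes-unique : (ℝ : CompleteOrderedField c ℓ₁ ℓ₂) (Λ : RankedLattice ℝ n p)
  (M : Measure ℝ n) {f g : SetFunction ℝ n} →
  Realizes ℝ Λ M f → Realizes ℝ Λ M g →
  let open CompleteOrderedField ℝ in ∀ A → f A ≈ g A
realizes-unique ℝ Λ M realizes-f realizes-g A =
  ≤-antisym (f≤g realizes-f realizes-g) (f≤g realizes-g realizes-f)
  where
  open OrderedField ℝ
  -- The member whose bound is attained by `g` at `A` also bounds `f`, because the bound involves
  -- only `rank` and `μ`.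
  f≤g : ∀ {f g} → Realizes ℝ Λ M f → Realizes ℝ Λ M g → f A ≤ g A
  f≤g realizes-f realizes-g =
    let (Z , rank+μ≤gA) = Necessity.rank+μ≤f ℝ Λ M realizes-g A
    in ≤-trans (Necessity.f≤rank+μ ℝ Λ M realizes-f A Z) rank+μ≤gA

theorem4 :
  ∀ {c ℓ₁ ℓ₂ p : Level} (ℝ : CompleteOrderedField c ℓ₁ ℓ₂) (n : ℕ)
    (Λ : RankedLattice ℝ n p) (M : Measure ℝ n) →
    let open CompleteOrderedField ℝ using (_≈_)
        open RankedLattice Λ using (rank)
        open Measure M using (μ)
    in
    (∃ (Realizes ℝ Λ M) ⇔ CyclicFlatAxioms ℝ Λ M) ×
    (CyclicFlatAxioms ℝ Λ M →
      ∃! (λ f g → ∀ A → f A ≈ g A) (Realizes ℝ Λ M) ×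
      (∀ f → Realizes ℝ Λ M f →
        IntegerValued ℝ f ⇔ (IntegerValued ℝ rank × IntegerValued ℝ μ)))
theorem4 ℝ n Λ M =
  mk⇔ (λ (_ , realizes) → Necessity.cyclicFlatAxioms ℝ Λ M realizes)
      (λ axioms → minimalBound ℝ Λ M axioms , realizes ℝ Λ M axioms) ,
  λ axioms →
    (minimalBound ℝ Λ M axioms , realizes ℝ Λ M axioms ,
     realizes-unique ℝ Λ M (realizes ℝ Λ M axioms)) ,
    λ f realizes → Necessity.integerValued⇔ ℝ Λ M realizes
  where open Sufficiency using (minimalBound; realizes)
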